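{- Neither the set of satisfiable uCLU sentences nor the set of unsatisfiable uCLU sentences is recursively enumerable. In particular, there cannot be any sound and refutationally complete calculus for uCLU.
   Context: CLU is a quantifier-free language over the integers $\mathbb{Z}$ with uninterpreted function symbols (including constant symbols, and of arbitrary arities, mapping integers to integers) and uninterpreted predicate symbols over the integers. The only arithmetic operators are the successor operator $\mathrm{succ}$ and the predecessor operator $\mathrm{pred}$ (interpreted as $x\mapsto x+1$ and $x\mapsto x-1$ on $\mathbb{Z}$); there is no interpreted constant for zero. Integer terms are built from integer variables, applications of function symbols, $\mathrm{succ}$, $\mathrm{pred}$, and an if-then-else operator $\mathrm{ITE}(\varphi,t_1,t_2)$. Formulas are Boolean combinations of atoms $t_1=t_2$, $t_1<t_2$ (with the standard meaning on $\mathbb{Z}$) and of applications of predicate symbols to integer terms. In addition, for convenience, functions and predicates may be given by lambda abstraction over integer variables and applied to integer terms. uCLU is the extension of CLU by universal quantification of integer variables: uCLU sentences are of the form $\forall x_1\ldots x_n.\,\varphi$ with $\varphi$ a CLU formula whose integer variables are among $x_1,\ldots,x_n$, the quantifiers ranging over $\mathbb{Z}$. A uCLU sentence is satisfiable if there is an interpretation with domain $\mathbb{Z}$, with $\mathrm{succ},\mathrm{pred},=,<$ interpreted in the standard way and the uninterpreted symbols interpreted by arbitrary total functions and relations over $\mathbb{Z}$, that makes it true; otherwise it is unsatisfiable. A calculus (an effective system of inference rules, so that the set of sentences it refutes by finite derivations is recursively enumerable) is sound and refutationally complete for uCLU if it derives falsity in finitely many steps from exactly the unsatisfiable uCLU sentences.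 -}

module Defs where

open import Data.Bool.Base using (Bool; true; false; not; _∧_; _∨_; if_then_else_)
open import Data.Fin.Base using (Fin; toℕ)
open import Data.Integer.Base as ℤ using (ℤ)
import Data.Integer.Properties as ℤ
open import Data.List.Base using (List)
open import Data.List.Relation.Unary.All using (All)
open import Data.Nat.Base using (ℕ; zero; suc; _+_; _<_)
open import Data.Product.Base using (Σ; ∃; _,_)
open import Data.Vec.Base using (Vec; []; _∷_; _++_; lookup)
open import Data.Vec.Relation.Binary.Pointwise.Inductive using (Pointwise)
open import Function.Bundles using (_⇔_)
open import Relation.Binary.PropositionalEquality using (_≡_)
open import Relation.Nullary.Decidable.Core using (does)
open import Relation.Nullary.Negation.Core using (¬_)

private
  variable
    k m n : ℕ

infix  7 ¬′_
infixr 6 _∧′_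
infixr 5 _∨′_
infix  8 _≐_ _≺_

-- The index n is the number of integer variables in scope.  Every arity k has
-- countably many uninterpreted function and predicate symbols, so a symbol is
-- given by its arity and a number; constant symbols are those of arity 0.
-- A k-ary lambda abstraction binds the first k variables of its body.

mutual

  data Term (n : ℕ) : Set where
    var  : Fin n → Term n
    app  : ∀ {k} → Function n k → Vec (Term n) k → Term n
    succ : Term n → Term n
    pred : Term n → Term n
    ITE  : Formula n → Term n → Term n → Term n

  data Function (n k : ℕ) : Set where
    sym : ℕ → Function n k
    lam : Term (k + n) → Function n k

  data Formula (n : ℕ) : Set where
    ⊤′   : Formula n
    ⊥′   : Formula n
    ¬′_  : Formula n → Formula n
    _∧′_ : Formula n → Formula n → Formula n
    _∨′_ : Formula n → Formula n → Formula n
    _≐_  : Term n → Term n → Formula n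
    _≺_  : Term n → Term n → Formula n
    app  : ∀ {k} → Predicate n k → Vec (Term n) k → Formula n

  data Predicate (n k : ℕ) : Set where
    sym : ℕ → Predicate n k
    lam : Formula (k + n) → Predicate n k

-- ∀′ n φ is the sentence ∀ x₁ … xₙ. φ.
data Sentence : Set where
  ∀′ : (n : ℕ) → Formula n → Sentence

-- Relations over ℤ are given by their characteristic functions, which is what
-- makes ITE a total operation without assuming excluded middle.
record Interpretation : Set where
  field
    function : (k i : ℕ) → Vec ℤ k → ℤ
    relation : (k i : ℕ) → Vec ℤ k → Bool

module Semantics (I : Interpretation) where
  open Interpretation I

  mutual

    ⟦_⟧ᵗ : Term n → Vec ℤ n → ℤ
    ⟦ var i ⟧ᵗ       ρ = lookup ρ i
    ⟦ app f ts ⟧ᵗ    ρ = ⟦ f ⟧ᶠ ρ (⟦ ts ⟧* ρ)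
    ⟦ succ t ⟧ᵗ      ρ = ℤ.suc (⟦ t ⟧ᵗ ρ)
    ⟦ pred t ⟧ᵗ      ρ = ℤ.pred (⟦ t ⟧ᵗ ρ)
    ⟦ ITE φ t₁ t₂ ⟧ᵗ ρ = if ⟦ φ ⟧ ρ then ⟦ t₁ ⟧ᵗ ρ else ⟦ t₂ ⟧ᵗ ρ

    ⟦_⟧* : Vec (Term n) k → Vec ℤ n → Vec ℤ k
    ⟦ [] ⟧*     ρ = []
    ⟦ t ∷ ts ⟧* ρ = ⟦ t ⟧ᵗ ρ ∷ ⟦ ts ⟧* ρ

    ⟦_⟧ᶠ : Function n k → Vec ℤ n → Vec ℤ k → ℤ
    ⟦_⟧ᶠ {k = k} (sym i) ρ xs = function k i xs
    ⟦ lam t ⟧ᶠ           ρ xs = ⟦ t ⟧ᵗ (xs ++ ρ)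

    ⟦_⟧ : Formula n → Vec ℤ n → Bool
    ⟦ ⊤′ ⟧       ρ = true
    ⟦ ⊥′ ⟧       ρ = false
    ⟦ ¬′ φ ⟧     ρ = not (⟦ φ ⟧ ρ)
    ⟦ φ ∧′ ψ ⟧   ρ = ⟦ φ ⟧ ρ ∧ ⟦ ψ ⟧ ρ
    ⟦ φ ∨′ ψ ⟧   ρ = ⟦ φ ⟧ ρ ∨ ⟦ ψ ⟧ ρ
    ⟦ t ≐ u ⟧    ρ = does (⟦ t ⟧ᵗ ρ ℤ.≟ ⟦ u ⟧ᵗ ρ)
    ⟦ t ≺ u ⟧    ρ = does (⟦ t ⟧ᵗ ρ ℤ.<? ⟦ u ⟧ᵗ ρ)
    ⟦ app p ts ⟧ ρ = ⟦ p ⟧ᵖ ρ (⟦ ts ⟧* ρ)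

    ⟦_⟧ᵖ : Predicate n k → Vec ℤ n → Vec ℤ k → Bool
    ⟦_⟧ᵖ {k = k} (sym i) ρ xs = relation k i xs
    ⟦ lam φ ⟧ᵖ           ρ xs = ⟦ φ ⟧ (xs ++ ρ)

infix 4 _⊨_

_⊨_ : Interpretation → Sentence → Set
I ⊨ ∀′ n φ = (ρ : Vec ℤ n) → Semantics.⟦_⟧ I φ ρ ≡ true

Satisfiable : Sentence → Set
Satisfiable s = ∃ λ I → I ⊨ s

Unsatisfiable : Sentence → Set
Unsatisfiable s = ¬ Satisfiable s

data PartialRecursive : ℕ → Set where
  zero : PartialRecursive 0
  succ : PartialRecursive 1
  proj : Fin n → PartialRecursive n
  comp : PartialRecursive m → Vec (PartialRecursive n) m → PartialRecursive n
  prec : PartialRecursive n → PartialRecursive (2 + n) → PartialRecursive (1 + n)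
  μ    : PartialRecursive (1 + n) → PartialRecursive n

infix 4 _[_]⇓_

-- f [ xs ]⇓ y: the value of f at xs is defined and equal to y.
data _[_]⇓_ : PartialRecursive n → Vec ℕ n → ℕ → Set where
  zero     : zero [ [] ]⇓ 0
  succ     : ∀ {x} → succ [ x ∷ [] ]⇓ suc x
  proj     : ∀ {i : Fin n} {xs} → proj i [ xs ]⇓ lookup xs i
  comp     : ∀ {f : PartialRecursive m} {gs : Vec (PartialRecursive n) m} {xs ys z} →
             Pointwise (λ g y → g [ xs ]⇓ y) gs ys → f [ ys ]⇓ z →
             comp f gs [ xs ]⇓ z
  prec-zero : ∀ {f : PartialRecursive n} {g xs y} →
             f [ xs ]⇓ y →
             prec f g [ 0 ∷ xs ]⇓ y
  prec-suc : ∀ {f : PartialRecursive n} {g x xs y z} →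
             prec f g [ x ∷ xs ]⇓ y → g [ x ∷ y ∷ xs ]⇓ z →
             prec f g [ suc x ∷ xs ]⇓ z
  μ        : ∀ {f : PartialRecursive (1 + n)} {xs y} →
             (∀ x → x < y → ∃ λ z → f [ x ∷ xs ]⇓ suc z) → f [ y ∷ xs ]⇓ 0 →
             μ f [ xs ]⇓ y

infix 4 _↓_

_↓_ : PartialRecursive n → Vec ℕ n → Set
f ↓ xs = ∃ λ y → f [ xs ]⇓ y

-- The Cantor pairing function; it makes the Gödel numbering below injective on
-- the sentences (and on the formulas with a given number of variables).

triangular : ℕ → ℕ
triangular zero    = 0
triangular (suc n) = suc n + triangular n

pair : ℕ → ℕ → ℕ
pair a b = triangular (a + b) + b

mutual

  ⌜_⌝ᵗ : Term n → ℕ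
  ⌜ var i ⌝ᵗ            = pair 0 (toℕ i)
  ⌜ app {k = k} f ts ⌝ᵗ = pair 1 (pair k (pair ⌜ f ⌝ᶠ ⌜ ts ⌝*))
  ⌜ succ t ⌝ᵗ           = pair 2 ⌜ t ⌝ᵗ
  ⌜ pred t ⌝ᵗ           = pair 3 ⌜ t ⌝ᵗ
  ⌜ ITE φ t₁ t₂ ⌝ᵗ      = pair 4 (pair ⌜ φ ⌝ (pair ⌜ t₁ ⌝ᵗ ⌜ t₂ ⌝ᵗ))

  ⌜_⌝* : Vec (Term n) k → ℕ
  ⌜ [] ⌝*     = 0
  ⌜ t ∷ ts ⌝* = suc (pair ⌜ t ⌝ᵗ ⌜ ts ⌝*)

  ⌜_⌝ᶠ : Function n k → ℕ
  ⌜ sym i ⌝ᶠ = pair 0 i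
  ⌜ lam t ⌝ᶠ = pair 1 ⌜ t ⌝ᵗ

  ⌜_⌝ : Formula n → ℕ
  ⌜ ⊤′ ⌝               = pair 0 0
  ⌜ ⊥′ ⌝               = pair 1 0
  ⌜ ¬′ φ ⌝             = pair 2 ⌜ φ ⌝
  ⌜ φ ∧′ ψ ⌝           = pair 3 (pair ⌜ φ ⌝ ⌜ ψ ⌝)
  ⌜ φ ∨′ ψ ⌝           = pair 4 (pair ⌜ φ ⌝ ⌜ ψ ⌝)
  ⌜ t ≐ u ⌝            = pair 5 (pair ⌜ t ⌝ᵗ ⌜ u ⌝ᵗ)
  ⌜ t ≺ u ⌝            = pair 6 (pair ⌜ t ⌝ᵗ ⌜ u ⌝ᵗ)
  ⌜ app {k = k} p ts ⌝ = pair 7 (pair k (pair ⌜ p ⌝ᵖ ⌜ ts ⌝*))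

  ⌜_⌝ᵖ : Predicate n k → ℕ
  ⌜ sym i ⌝ᵖ = pair 0 i
  ⌜ lam φ ⌝ᵖ = pair 1 ⌜ φ ⌝

⌜_⌝ˢ : Sentence → ℕ
⌜ ∀′ n φ ⌝ˢ = pair n ⌜ φ ⌝

-- A set of sentences is recursively enumerable if it is the domain of a
-- partial recursive function.  Numbers that code no sentence form a decidable
-- set, so the behaviour of the function on them is irrelevant.
RecursivelyEnumerable : (Sentence → Set) → Set
RecursivelyEnumerable S =
  Σ (PartialRecursive 1) λ f → ∀ s → S s ⇔ f ↓ (⌜ s ⌝ˢ ∷ [])

-- Inference rules act on an arbitrary kind of expressions (sentences, clauses,
-- sequents, …); `initial s` is the set of expressions that a derivation from
-- the sentence s may start with, such as the clauses of a normal form of s.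
record InferenceSystem : Set₁ where
  field
    Expression : Set
    falsity    : Expression
    initial    : Sentence → Expression → Set
    rule       : List Expression → Expression → Set

module _ (C : InferenceSystem) where
  open InferenceSystem C

  data Derivable (s : Sentence) : Expression → Set where
    start : ∀ {e} → initial s e → Derivable s e
    infer : ∀ {es e} → rule es e → All (Derivable s) es → Derivable s e

  Refutes : Sentence → Set
  Refutes s = Derivable s falsity

-- Effectiveness enters only through the recursive enumerability of the set of
-- refutable sentences, so it is imposed in that form, the weakest one.
record Calculus : Set₁ where
  field
    system    : InferenceSystem
    effective : RecursivelyEnumerable (Refutes system)

SoundAndRefutationallyComplete : Calculus → Set
SoundAndRefutationallyComplete C =
  ∀ s → Refutes (Calculus.system C) s ⇔ Unsatisfiable s

{-# OPTIONS --safe #-}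
module Submission where

-- Over the standard integers, a universal sentence whose variables range over
-- the numbers above an arbitrary origin determines its function symbols on
-- these numbers if it contains their recursion equations.  Partial recursive
-- functions thus become definable once they are made total by a bound t (the
-- fuel) on their unbounded searches.  Divergence of g on given inputs says that
-- the fuelled evaluation fails for all t, which takes a universal variable;
-- termination says that it succeeds for some t, which takes a constant symbol.
-- Hence termination and divergence are both reducible to satisfiability, and a
-- diagonal argument refutes enumerations of the satisfiable as well as of the
-- unsatisfiable sentences.

open import Algebra.Properties.AbelianGroup using (∙-cancelˡ; xyx⁻¹≈y)
open import Algebra.Properties.CommutativeSemigroup using (x∙yz≈y∙xz)
open import Data.Bool.Base using (true; false; not; _∧_; _∨_; if_then_else_)
open import Data.Fin.Base using (zero; suc; toℕ)
open import Data.Integer.Base as ℤ using (ℤ; +_; ∣_∣)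
import Data.Integer.Properties as ℤ
open import Data.List.Base as List using (List; []; _∷_; _++_)
open import Data.List.Extrema.Nat using (max; xs≤max)
open import Data.List.Membership.Propositional using (_∈_)
open import Data.List.Membership.Propositional.Properties using (∈-++⁺ˡ; ∈-++⁺ʳ; ∈-map⁺)
open import Data.List.Relation.Binary.Subset.Propositional using (_⊆_)
import Data.List.Relation.Unary.All as All
open import Data.List.Relation.Unary.Any using (here; there; index)
open import Data.Nat.Base as ℕ using (ℕ; zero; suc; _+_; _≤_; _<_; _⊔_; z≤n; s≤s)
open import Data.Nat.Properties
  using (≤-refl; ≤-trans; ≤-pred; m≤m⊔n; m≤n⊔m; m≤n⇒m<n∨m≡n; n≮n; n≤1+n; m≤n+m;
         +-suc; +-identityʳ; suc-injective; 0≢1+n)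
open import Data.Product.Base using (Σ; ∃; _×_; _,_; proj₁; proj₂)
open import Data.Sum.Base using (inj₁; inj₂)
open import Data.Unit.Base using (⊤; tt)
open import Data.Vec.Base as Vec using (Vec; []; _∷_; head; tail; lookup; map; tabulate)
open import Data.Vec.Properties
  using (lookup-map; map-id; map-∘; tabulate∘lookup)
open import Data.Vec.Relation.Binary.Pointwise.Inductive as Pointwise
  using (Pointwise; []; _∷_; tabulate⁺)
open import Function.Base using (_∘_; id)
open import Function.Bundles using (_⇔_; mk⇔; Equivalence)
open import Function.Properties.Equivalence using () renaming (sym to ⇔-sym; trans to ⇔-trans)
open import Function.Related.TypeIsomorphisms using (¬-cong-⇔)
open import Relation.Binary.PropositionalEquality as ≡
  using (_≡_; _≢_; refl; cong; cong₂; trans; subst)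
open import Relation.Nullary.Decidable using (Dec; yes; no; does; dec-true; dec-false)
open import Relation.Nullary.Negation.Core using (¬_; contradiction)
open import Defs

private
  variable
    k m n : ℕ

-- Evaluation of partial recursive functions with fuel.

ifZero : ℕ → ℕ → ℕ → ℕ
ifZero zero    y z = y
ifZero (suc _) y z = z

strict : Vec ℕ m → ℕ → ℕ
strict []       y = y
strict (x ∷ xs) y = ifZero x 0 (strict xs y)

recurse : (Vec ℕ n → ℕ) → (Vec ℕ (2 + n) → ℕ) → ℕ → Vec ℕ n → ℕ
recurse f g zero    xs = f xs
recurse f g (suc x) xs =
  ifZero (recurse f g x xs) 0 (g (x ∷ ℕ.pred (recurse f g x xs) ∷ xs))

-- `b` is the number of candidates that may still be tried from `y` on. The values of `h` are
-- shifted by one: 1 signals a root, a value of at least 2 sends the search to the next candidate,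
-- and 0 makes the whole search fail, as an undefined value does for `μ`.
search : (ℕ → ℕ) → ℕ → ℕ → ℕ
search h zero    y = 0
search h (suc b) y =
  ifZero (h y) 0 (ifZero (ℕ.pred (h y)) (suc y) (search h b (suc y)))

-- eval f t xs is 0 if the value of f at xs is not found with fuel t, and
-- suc y if it is found to be y; only the searches for μ consume fuel.
mutual

  eval : PartialRecursive n → ℕ → Vec ℕ n → ℕ
  eval zero        t []       = 1
  eval succ        t (x ∷ []) = 2 + x
  eval (proj i)    t xs       = suc (lookup xs i)
  eval (comp f gs) t xs       =
    strict (eval* gs t xs) (eval f t (map ℕ.pred (eval* gs t xs)))
  eval (prec f g)  t (x ∷ xs) = recurse (eval f t) (eval g t) x xs
  eval (μ f)       t xs       = search (λ y → eval f t (y ∷ xs)) t 0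

  eval* : Vec (PartialRecursive n) m → ℕ → Vec ℕ n → Vec ℕ m
  eval* []       t xs = []
  eval* (g ∷ gs) t xs = eval g t xs ∷ eval* gs t xs

-- Soundness of fuelled evaluation.

strict⁻ : ∀ (xs : Vec ℕ m) {y z} → strict xs y ≡ suc z →
          xs ≡ map suc (map ℕ.pred xs) × y ≡ suc z
strict⁻ []           eq = refl , eq
strict⁻ (suc x ∷ xs) eq with strict⁻ xs eq
... | xs≡ , y≡ = cong (suc x ∷_) xs≡ , y≡

-- Induction on `b`. The recursive call accounts for the candidates from `suc y` on, so only `x = y`
-- remains, where the search continued because `h y` was at least 2.
search⁻ : ∀ h b y {r} → search h b y ≡ suc r →
          (∀ x → y ≤ x → x < r → ∃ λ z → h x ≡ 2 + z) × h r ≡ 1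
search⁻ h (suc b) y eq with h y in hy
search⁻ h (suc b) y refl | suc zero =
  (λ x y≤x x<y → contradiction (≤-trans x<y y≤x) (n≮n x)) , hy
search⁻ h (suc b) y eq | suc (suc z) with search⁻ h b (suc y) eq
... | below , hr = (λ x y≤x x<r → continues x x<r (m≤n⇒m<n∨m≡n y≤x)) , hr
  where
  continues : ∀ x → x < _ → _ → ∃ λ z → h x ≡ 2 + z
  continues x x<r (inj₁ y<x)  = below x y<x x<r
  continues x x<r (inj₂ refl) = z , hy

mutual

  eval-sound : ∀ (f : PartialRecursive n) t xs {y} →
               eval f t xs ≡ suc y → f [ xs ]⇓ y
  eval-sound zero        t []       refl = zero
  eval-sound succ        t (x ∷ []) refl = succ
  eval-sound (proj i)    t xs       refl = proj
  eval-sound (comp f gs) t xs       eq with strict⁻ (eval* gs t xs) eq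
  ... | ys≡ , z≡ = comp (eval*-sound gs t xs ys≡) (eval-sound f t _ z≡)
  eval-sound (prec f g)  t (x ∷ xs) eq = recurse-sound f g t x xs eq
  eval-sound (μ f)       t xs       eq with search⁻ (λ y → eval f t (y ∷ xs)) t 0 eq
  ... | below , at =
    μ (λ x x<y → let z , eq = below x z≤n x<y in z , eval-sound f t _ eq)
      (eval-sound f t _ at)

  eval*-sound : ∀ (gs : Vec (PartialRecursive n) m) t xs {ys} →
                eval* gs t xs ≡ map suc ys →
                Pointwise (λ g y → g [ xs ]⇓ y) gs ys
  eval*-sound []       t xs {[]}     eq = []
  eval*-sound (g ∷ gs) t xs {y ∷ ys} eq =
    eval-sound g t xs (cong head eq) ∷
    eval*-sound gs t xs (cong tail eq)

  recurse-sound : ∀ (f : PartialRecursive n) g t x xs {y} →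
                  recurse (eval f t) (eval g t) x xs ≡ suc y →
                  prec f g [ x ∷ xs ]⇓ y
  recurse-sound f g t zero    xs eq = prec-zero (eval-sound f t xs eq)
  recurse-sound f g t (suc x) xs eq with recurse (eval f t) (eval g t) x xs in r≡
  ... | suc y = prec-suc (recurse-sound f g t x xs r≡) (eval-sound g t _ eq)

-- Completeness of fuelled evaluation.

-- Closure under finite conjunction lets the fuel demands of subcomputations be merged by taking
-- maxima; this replaces a proof that evaluation is monotone in the fuel.
Eventually : (ℕ → Set) → Set
Eventually P = ∃ λ t₀ → ∀ t → t₀ ≤ t → P t

zipEventually : ∀ {P Q R : ℕ → Set} → (∀ t → P t → Q t → R t) →
                Eventually P → Eventually Q → Eventually R
zipEventually f (a , p) (b , q) = a ⊔ b , λ t a⊔b≤t →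
  f t (p t (≤-trans (m≤m⊔n a b) a⊔b≤t)) (q t (≤-trans (m≤n⊔m a b) a⊔b≤t))

allEventually : ∀ {P : ℕ → ℕ → Set} y → (∀ x → x < y → Eventually (P x)) →
                Eventually (λ t → ∀ x → x < y → P x t)
allEventually zero    p = 0 , λ _ _ _ ()
allEventually (suc y) p =
  zipEventually (λ t → extend t)
    (allEventually y (λ x x<y → p x (≤-trans x<y (n≤1+n y)))) (p y ≤-refl)
  where
  extend : ∀ t → _ → _ → ∀ x → x < suc y → _
  extend t below at x x≤y with m≤n⇒m<n∨m≡n (≤-pred x≤y)
  ... | inj₁ x<y  = below x x<y
  ... | inj₂ refl = at

strict-map-suc : ∀ (ys : Vec ℕ m) z → strict (map suc ys) z ≡ z
strict-map-suc []       z = refl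
strict-map-suc (y ∷ ys) z = strict-map-suc ys z

map-pred-suc : ∀ (ys : Vec ℕ m) → map ℕ.pred (map suc ys) ≡ ys
map-pred-suc []       = refl
map-pred-suc (y ∷ ys) = cong (y ∷_) (map-pred-suc ys)

-- Induction on the distance `d` from the current candidate to the root: every candidate passed
-- costs one unit of fuel. The hypothesis on all `x` below the root does not mention where the
-- search started, so it carries over to the next candidate up to `+-suc`.
search⁺ : ∀ h b y d → d < b → (∀ x → x < d + y → ∃ λ z → h x ≡ 2 + z) →
          h (d + y) ≡ 1 → search h b y ≡ suc (d + y)
search⁺ h (suc b) y zero    d<b       below at rewrite at = refl
search⁺ h (suc b) y (suc d) (s≤s d<b) below at with below y (s≤s (m≤n+m y d))
... | z , hy rewrite hy =
  trans (search⁺ h b (suc y) d d<b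
          (subst (λ e → ∀ x → x < e → ∃ λ z → h x ≡ 2 + z) (≡.sym (+-suc d y)) below)
          (subst (λ e → h e ≡ 1) (≡.sym (+-suc d y)) at))
        (cong suc (+-suc d y))

mutual

  eval-complete : ∀ {f : PartialRecursive n} {xs y} → f [ xs ]⇓ y →
                  Eventually (λ t → eval f t xs ≡ suc y)
  eval-complete zero        = 0 , λ _ _ → refl
  eval-complete succ        = 0 , λ _ _ → refl
  eval-complete proj        = 0 , λ _ _ → refl
  eval-complete (comp {f = f} {gs} {xs} {ys} {z} ds d) =
    zipEventually step (eval*-complete ds) (eval-complete d)
    where
    step : ∀ t → eval* gs t xs ≡ map suc ys → eval f t ys ≡ suc z →
           eval (comp f gs) t xs ≡ suc z
    step t eqs eq rewrite eqs | map-pred-suc ys | eq = strict-map-suc ys (suc z)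
  eval-complete (prec-zero d)    = eval-complete d
  eval-complete (prec-suc {f = f} {g} {x} {xs} {y} {z} d e) =
    zipEventually step (eval-complete d) (eval-complete e)
    where
    step : ∀ t → recurse (eval f t) (eval g t) x xs ≡ suc y →
           eval g t (x ∷ y ∷ xs) ≡ suc z →
           recurse (eval f t) (eval g t) (suc x) xs ≡ suc z
    step t eq eq′ rewrite eq = eq′
  eval-complete (μ {f = f} {xs} {y} ds d) =
    zipEventually (λ t eqs f → f eqs)
      (allEventually y λ x x<y → positive-complete (ds x x<y))
      -- From the threshold `suc y` on, the fuel exceeds `y`, as a search from 0 that has to reach
      -- `y` requires.
      (zipEventually step (suc y , λ _ y<t → y<t) (eval-complete d))
    where
    step : ∀ t → y < t → eval f t (y ∷ xs) ≡ 1 →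
           (∀ x → x < y → ∃ λ z → eval f t (x ∷ xs) ≡ 2 + z) →
           eval (μ f) t xs ≡ suc y
    step t y<t at below = subst
      (λ e → (∀ x → x < e → ∃ λ z → eval f t (x ∷ xs) ≡ 2 + z) →
             eval f t (e ∷ xs) ≡ 1 → eval (μ f) t xs ≡ suc e)
      (+-identityʳ y) (search⁺ (λ x → eval f t (x ∷ xs)) t 0 y y<t) below at

  positive-complete : ∀ {f : PartialRecursive n} {xs} →
                      (∃ λ z → f [ xs ]⇓ suc z) →
                      Eventually (λ t → ∃ λ z → eval f t xs ≡ 2 + z)
  positive-complete (z , d) with eval-complete d
  ... | t₀ , eq = t₀ , λ t t₀≤t → z , eq t t₀≤t

  eval*-complete : ∀ {gs : Vec (PartialRecursive n) m} {xs ys} →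
                   Pointwise (λ g y → g [ xs ]⇓ y) gs ys →
                   Eventually (λ t → eval* gs t xs ≡ map suc ys)
  eval*-complete []       = 0 , λ _ _ → refl
  eval*-complete (d ∷ ds) =
    zipEventually (λ t → cong₂ _∷_) (eval-complete d) (eval*-complete ds)

-- With enough fuel for both derivations, the single function `eval` returns both values.
⇓-deterministic : ∀ {f : PartialRecursive n} {xs y z} →
                  f [ xs ]⇓ y → f [ xs ]⇓ z → y ≡ z
⇓-deterministic d e
  with zipEventually (λ t p q → trans (≡.sym p) q) (eval-complete d) (eval-complete e)
... | t₀ , eq = suc-injective (eq t₀ ≤-refl)

-- Translation into terms and recursion equations.

resize : {A : Set} → A → ∀ n → Vec A m → Vec A n
resize d zero    xs       = []
resize d (suc n) []       = d ∷ resize d n []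
resize d (suc n) (x ∷ xs) = x ∷ resize d n xs

resize-id : {A : Set} (d : A) (xs : Vec A n) → resize d n xs ≡ xs
resize-id d []       = refl
resize-id d (x ∷ xs) = cong (x ∷_) (resize-id d xs)

-- Any values for the first `m` of `n` variables extend to all of them. An axiom in the first
-- variables of a longer quantifier prefix can thus be instantiated freely.
resize-resize : {A : Set} (d : A) (xs : Vec A m) → m ≤ n →
                resize d m (resize d n xs) ≡ xs
resize-resize d []       m≤n       = refl
resize-resize d (x ∷ xs) (s≤s m≤n) = cong (x ∷_) (resize-resize d xs m≤n)

-- A node (k , F) asks for a function symbol of arity 1 + k that denotes F.
-- Symbols of arity 0 are thereby kept free for constants.
Node : Set
Node = ∃ λ k → Vec ℕ (suc k) → ℕ

recurseNode : PartialRecursive n → PartialRecursive (2 + n) → Vec ℕ (2 + n) → ℕ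
recurseNode f g (t ∷ x ∷ xs) = recurse (eval f t) (eval g t) x xs

-- The bound `b` is an argument apart from the fuel `t`: it decreases along the search, while each
-- call of `f` receives the full `t`.
searchNode : PartialRecursive (1 + n) → Vec ℕ (3 + n) → ℕ
searchNode f (t ∷ b ∷ y ∷ xs) = search (λ y → eval f t (y ∷ xs)) b y

mutual

  -- Only recursion and search need a symbol with axioms; the other constructors unfold into terms.
  nodes : PartialRecursive n → List Node
  nodes zero        = []
  nodes succ        = []
  nodes (proj i)    = []
  nodes (comp f gs) = nodes f ++ nodes* gs
  nodes (prec f g)  = (_ , recurseNode f g) ∷ nodes f ++ nodes g
  nodes (μ f)       = (_ , searchNode f) ∷ nodes f

  nodes* : Vec (PartialRecursive n) m → List Node
  nodes* []       = []
  nodes* (g ∷ gs) = nodes g ++ nodes* gs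

-- The constant 0 stands for the origin; its value is an arbitrary integer.  The
-- constants 1 and 2 are the inputs of a computation, and 3 is its fuel.
constant : ℕ → Term n
constant i = app {k = 0} (sym i) []

origin : Term n
origin = constant 0

ifOrigin : Term n → Term n → Term n → Term n
ifOrigin t u v = ITE (t ≐ origin) u v

-- The counterpart of the truncated `ℕ.pred`, which never leads below the origin.
pred₀ : Term n → Term n
pred₀ t = ifOrigin t origin (pred t)

strictᵗ : Vec (Term n) m → Term n → Term n
strictᵗ []       u = u
strictᵗ (t ∷ ts) u = ifOrigin t origin (strictᵗ ts u)

numeral : ℕ → Term n
numeral zero    = origin
numeral (suc k) = succ (numeral k)

nonNegative : Vec (Term n) m → Formula n
nonNegative []       = ⊤′
nonNegative (t ∷ ts) = ¬′ (t ≺ origin) ∧′ nonNegative ts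

variables : Vec (Term n) n
variables = tabulate var

-- The inputs are fixed by equations instead of substitution. Hence `φ` and its code do not depend
-- on them, and the code of the sentence is easy to compute from the code of `φ`.
withInputs : Formula n → ℕ → ℕ → Sentence
withInputs {n} φ q r = ∀′ n (φ ∧′ constant 1 ≐ numeral q ∧′ constant 2 ≐ numeral r)

-- The code of a formula does not record how many variables are in scope, but the code of a sentence
-- does; this is why there is a second input.
selfApplied : Formula n → Sentence
selfApplied {n} φ = withInputs φ ⌜ φ ⌝ n

module Translation (L : List Node) (N : ℕ) where

  -- A symbol is numbered by its position in `L`. The list stays fixed while the translation
  -- descends into subprograms, so the numbers of different nodes do not clash.
  symbol : ∀ {s} → s ∈ L → Function N (suc (proj₁ s))
  symbol s∈L = sym (toℕ (index s∈L))

  mutual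

    translate : (f : PartialRecursive n) → nodes f ⊆ L →
                Term N → Vec (Term N) n → Term N
    translate zero        ⊆L t []       = succ origin
    translate succ        ⊆L t (u ∷ []) = succ (succ u)
    translate (proj i)    ⊆L t us       = succ (lookup us i)
    translate (comp f gs) ⊆L t us       =
      strictᵗ vs (translate f (⊆L ∘ ∈-++⁺ˡ) t (map pred₀ vs))
      where vs = translate* gs (⊆L ∘ ∈-++⁺ʳ (nodes f)) t us
    translate (prec f g)  ⊆L t us       = app (symbol (⊆L (here refl))) (t ∷ us)
    translate (μ f)       ⊆L t us       =
      -- The fuel is also the initial bound on the number of candidates, and the search starts from
      -- 0.
      app (symbol (⊆L (here refl))) (t ∷ t ∷ origin ∷ us)

    translate* : (gs : Vec (PartialRecursive n) m) → nodes* gs ⊆ L →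
                 Term N → Vec (Term N) n → Vec (Term N) m
    translate* []       ⊆L t us = []
    translate* (g ∷ gs) ⊆L t us =
      translate g (⊆L ∘ ∈-++⁺ˡ) t us ∷ translate* gs (⊆L ∘ ∈-++⁺ʳ (nodes g)) t us

  recurseAxiom : (f : PartialRecursive n) (g : PartialRecursive (2 + n)) →
                 nodes (prec f g) ⊆ L → Vec (Term N) (2 + n) → Formula N
  recurseAxiom f g ⊆L (t ∷ x ∷ us) =
    app r (t ∷ origin ∷ us) ≐ translate f (⊆L ∘ there ∘ ∈-++⁺ˡ) t us ∧′
    app r (t ∷ succ x ∷ us) ≐
      ifOrigin v origin
        (translate g (⊆L ∘ there ∘ ∈-++⁺ʳ (nodes f)) t (x ∷ pred₀ v ∷ us))
    where
    r = symbol (⊆L (here refl))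
    v = app r (t ∷ x ∷ us)

  searchAxiom : (f : PartialRecursive (1 + n)) →
                nodes (μ f) ⊆ L → Vec (Term N) (3 + n) → Formula N
  searchAxiom f ⊆L (t ∷ b ∷ y ∷ us) =
    app s (t ∷ origin ∷ y ∷ us) ≐ origin ∧′
    app s (t ∷ succ b ∷ y ∷ us) ≐
      ifOrigin v origin (ifOrigin (pred₀ v) (succ y) (app s (t ∷ b ∷ succ y ∷ us)))
    where
    s = symbol (⊆L (here refl))
    v = translate f (⊆L ∘ there) t (y ∷ us)

  mutual

    axioms : (f : PartialRecursive n) → nodes f ⊆ L → Formula N
    axioms zero        ⊆L = ⊤′
    axioms succ        ⊆L = ⊤′
    axioms (proj i)    ⊆L = ⊤′
    axioms (comp f gs) ⊆L =
      axioms f (⊆L ∘ ∈-++⁺ˡ) ∧′ axioms* gs (⊆L ∘ ∈-++⁺ʳ (nodes f))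
    axioms (prec f g)  ⊆L =
      axioms f (⊆L ∘ there ∘ ∈-++⁺ˡ) ∧′
      axioms g (⊆L ∘ there ∘ ∈-++⁺ʳ (nodes f)) ∧′
      recurseAxiom f g ⊆L (resize origin _ variables)
    axioms (μ f)       ⊆L =
      axioms f (⊆L ∘ there) ∧′ searchAxiom f ⊆L (resize origin _ variables)

    axioms* : (gs : Vec (PartialRecursive n) m) → nodes* gs ⊆ L → Formula N
    axioms* []       ⊆L = ⊤′
    axioms* (g ∷ gs) ⊆L =
      axioms g (⊆L ∘ ∈-++⁺ˡ) ∧′ axioms* gs (⊆L ∘ ∈-++⁺ʳ (nodes g))

-- Numbers counted from the origin, and the truth of formulas about them.

∧-true⁻ : ∀ {a b} → a ∧ b ≡ true → a ≡ true × b ≡ true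
∧-true⁻ {true} {true} eq = refl , refl

∧-true⁺ : ∀ {a b} → a ≡ true → b ≡ true → a ∧ b ≡ true
∧-true⁺ refl refl = refl

does-true⁻ : ∀ {A : Set} (A? : Dec A) → does A? ≡ true → A
does-true⁻ (yes a) eq = a

does-false⁻ : ∀ {A : Set} (A? : Dec A) → not (does A?) ≡ true → ¬ A
does-false⁻ (no ¬a) eq = ¬a

does-false⁺ : ∀ {A : Set} (A? : Dec A) → ¬ A → not (does A?) ≡ true
does-false⁺ A? ¬a = cong not (dec-false A? ¬a)

module Denotation (I : Interpretation) where
  open Interpretation I
  open Semantics I

  -- The language has no zero, so in an arbitrary model the natural numbers are those integers that
  -- are reached from the value of constant 0.
  embed : ℕ → ℤ
  embed n = function 0 0 [] ℤ.+ + n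

  embed-injective : ∀ {m n} → embed m ≡ embed n → m ≡ n
  embed-injective eq = ℤ.+-injective (∙-cancelˡ ℤ.+-0-abelianGroup (function 0 0 []) _ _ eq)

  embed-suc : ∀ n → ℤ.suc (embed n) ≡ embed (suc n)
  embed-suc n = x∙yz≈y∙xz ℤ.+-commutativeSemigroup (+ 1) (function 0 0 []) (+ n)

  embed-pred : ∀ n → ℤ.pred (embed (suc n)) ≡ embed n
  embed-pred n = trans (cong ℤ.pred (≡.sym (embed-suc n))) (ℤ.pred-suc _)

  ≮origin⁻ : ∀ {i} → ¬ (i ℤ.< function 0 0 []) → ∃ λ n → i ≡ embed n
  ≮origin⁻ {i} i≮o = ∣ i ℤ.- o ∣ , ≡.sym (begin
    o ℤ.+ + ∣ i ℤ.- o ∣ ≡⟨ cong (ℤ._+_ o) (ℤ.0≤i⇒+∣i∣≡i (ℤ.i≤j⇒0≤j-i (ℤ.≮⇒≥ i≮o))) ⟩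
    o ℤ.+ (i ℤ.- o)     ≡⟨ ℤ.+-assoc o i (ℤ.- o) ⟨
    o ℤ.+ i ℤ.- o       ≡⟨ xyx⁻¹≈y ℤ.+-0-abelianGroup o i ⟩
    i                   ∎)
    where
    open ≡.≡-Reasoning
    o = function 0 0 []

  ≮origin⁺ : ∀ n → ¬ (embed n ℤ.< function 0 0 [])
  ≮origin⁺ n = ℤ.≤⇒≯ (ℤ.i≤i+j _ (+ n))

  module At {N} (ρ : Vec ℤ N) where

    infix 4 _≈_ _≈*_

    record _≈_ (u : Term N) (n : ℕ) : Set where
      constructor ⟨_⟩
      field value : ⟦ u ⟧ᵗ ρ ≡ embed n

    open _≈_ public

    _≈*_ : Vec (Term N) m → Vec ℕ m → Set
    _≈*_ = Pointwise _≈_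

    record Holds (φ : Formula N) : Set where
      constructor ⟨_⟩
      field truth : ⟦ φ ⟧ ρ ≡ true

    open Holds public

    values : ∀ {us : Vec (Term N) m} {ns} → us ≈* ns → ⟦ us ⟧* ρ ≡ map embed ns
    values []       = refl
    values (p ∷ ps) = cong₂ _∷_ (value p) (values ps)

    origin≈ : origin ≈ 0
    origin≈ = ⟨ ≡.sym (ℤ.+-identityʳ _) ⟩

    succ≈ : ∀ {u n} → u ≈ n → succ u ≈ suc n
    succ≈ ⟨ eq ⟩ = ⟨ trans (cong ℤ.suc eq) (embed-suc _) ⟩

    numeral≈ : ∀ n → numeral n ≈ n
    numeral≈ zero    = origin≈
    numeral≈ (suc n) = succ≈ (numeral≈ n)

    value≡⁻ : ∀ {u v m n} → u ≈ m → v ≈ n → ⟦ u ⟧ᵗ ρ ≡ ⟦ v ⟧ᵗ ρ → m ≡ n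
    value≡⁻ ⟨ p ⟩ ⟨ q ⟩ eq = embed-injective (trans (≡.sym p) (trans eq q))

    value≡⁺ : ∀ {u v m n} → u ≈ m → v ≈ n → m ≡ n → ⟦ u ⟧ᵗ ρ ≡ ⟦ v ⟧ᵗ ρ
    value≡⁺ ⟨ p ⟩ ⟨ q ⟩ refl = trans p (≡.sym q)

    -- Each branch is evaluated only under its own condition. `pred₀≈` relies on this, since
    -- `pred u` falls below the origin when `u` denotes 0.
    ifOrigin≈ : ∀ {u v w k m n} → u ≈ k → (k ≡ 0 → v ≈ m) → (k ≢ 0 → w ≈ n) →
                ifOrigin u v w ≈ ifZero k m n
    ifOrigin≈ {u} {v} {w} {zero} p q r = ⟨ trans
      (cong (if_then ⟦ v ⟧ᵗ ρ else ⟦ w ⟧ᵗ ρ)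
        (dec-true (_ ℤ.≟ _) (value≡⁺ p origin≈ refl)))
      (value (q refl)) ⟩
    ifOrigin≈ {u} {v} {w} {suc k} p q r = ⟨ trans
      (cong (if_then ⟦ v ⟧ᵗ ρ else ⟦ w ⟧ᵗ ρ)
        (dec-false (_ ℤ.≟ _) (0≢1+n ∘ ≡.sym ∘ value≡⁻ p origin≈)))
      (value (r λ ())) ⟩

    pred₀≈ : ∀ {u n} → u ≈ n → pred₀ u ≈ ℕ.pred n
    pred₀≈ {n = zero}  p = ifOrigin≈ {n = 0} p (λ _ → origin≈) (contradiction refl)
    pred₀≈ {n = suc n} p = ifOrigin≈ {m = 0} p (λ ()) λ _ →
      ⟨ trans (cong ℤ.pred (value p)) (embed-pred n) ⟩

    pred₀≈* : ∀ {us : Vec (Term N) m} {ns} → us ≈* ns →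
              map pred₀ us ≈* map ℕ.pred ns
    pred₀≈* []       = []
    pred₀≈* (p ∷ ps) = pred₀≈ p ∷ pred₀≈* ps

    strict≈ : ∀ {us : Vec (Term N) m} {ns v n} → us ≈* ns → v ≈ n →
              strictᵗ us v ≈ strict ns n
    strict≈ []       q = q
    strict≈ (p ∷ ps) q = ifOrigin≈ p (λ _ → origin≈) λ _ → strict≈ ps q

    ≐⁻ : ∀ {u v n} → Holds (u ≐ v) → v ≈ n → u ≈ n
    ≐⁻ ⟨ eq ⟩ ⟨ q ⟩ = ⟨ trans (does-true⁻ (_ ℤ.≟ _) eq) q ⟩

    ≐⁺ : ∀ {u v n} → u ≈ n → v ≈ n → Holds (u ≐ v)
    ≐⁺ p q = ⟨ dec-true (_ ℤ.≟ _) (value≡⁺ p q refl) ⟩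

    ≭origin⁻ : ∀ {u n} → Holds (¬′ (u ≐ origin)) → u ≈ n → n ≢ 0
    ≭origin⁻ ⟨ eq ⟩ p = does-false⁻ (_ ℤ.≟ _) eq ∘ value≡⁺ p origin≈

    ≭origin⁺ : ∀ {u n} → u ≈ n → n ≢ 0 → Holds (¬′ (u ≐ origin))
    ≭origin⁺ p n≢0 = ⟨ does-false⁺ (_ ℤ.≟ _) (n≢0 ∘ value≡⁻ p origin≈) ⟩

    ⊀origin⁻ : ∀ {u} → Holds (¬′ (u ≺ origin)) → ∃ λ n → u ≈ n
    ⊀origin⁻ ⟨ eq ⟩ with ≮origin⁻ (does-false⁻ (_ ℤ.<? _) eq)
    ... | n , p = n , ⟨ p ⟩

    ⊀origin⁺ : ∀ {u n} → u ≈ n → Holds (¬′ (u ≺ origin))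
    ⊀origin⁺ {n = n} ⟨ p ⟩ = ⟨ does-false⁺ (_ ℤ.<? _)
      (subst (λ i → ¬ (i ℤ.< _)) (≡.sym p) (≮origin⁺ n)) ⟩

    ∧⁻ : ∀ {φ ψ} → Holds (φ ∧′ ψ) → Holds φ × Holds ψ
    ∧⁻ ⟨ eq ⟩ with ∧-true⁻ eq
    ... | eq₁ , eq₂ = ⟨ eq₁ ⟩ , ⟨ eq₂ ⟩

    ∧⁺ : ∀ {φ ψ} → Holds φ → Holds ψ → Holds (φ ∧′ ψ)
    ∧⁺ ⟨ eq₁ ⟩ ⟨ eq₂ ⟩ = ⟨ ∧-true⁺ eq₁ eq₂ ⟩

    ⊤⁺ : Holds ⊤′
    ⊤⁺ = ⟨ refl ⟩

    ⇒⁻ : ∀ {φ ψ} → Holds (¬′ φ ∨′ ψ) → Holds φ → Holds ψ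
    ⇒⁻ ⟨ eq ⟩ ⟨ eq₁ ⟩ rewrite eq₁ = ⟨ eq ⟩

    ⇒⁺ : ∀ {φ ψ} → (Holds φ → Holds ψ) → Holds (¬′ φ ∨′ ψ)
    ⇒⁺ {φ} {ψ} h = ⟨ lemma (⟦ φ ⟧ ρ) (λ eq → truth (h ⟨ eq ⟩)) ⟩
      where
      lemma : ∀ a {b} → (a ≡ true → b ≡ true) → not a ∨ b ≡ true
      lemma true  h = h refl
      lemma false h = refl

    nonNegative⁻ : ∀ (us : Vec (Term N) m) → Holds (nonNegative us) →
                   ∃ λ ns → us ≈* ns
    nonNegative⁻ []       h = [] , []
    nonNegative⁻ (u ∷ us) h =
      let h₁ , h₂ = ∧⁻ h; n , p = ⊀origin⁻ h₁; ns , ps = nonNegative⁻ us h₂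
      in n ∷ ns , p ∷ ps

    nonNegative⁺ : ∀ {us : Vec (Term N) m} {ns} → us ≈* ns → Holds (nonNegative us)
    nonNegative⁺ []       = ⊤⁺
    nonNegative⁺ (p ∷ ps) = ∧⁺ (⊀origin⁺ p) (nonNegative⁺ ps)

    resize≈ : ∀ k {us : Vec (Term N) m} {ns} → us ≈* ns →
              resize origin k us ≈* resize 0 k ns
    resize≈ zero    ps       = []
    resize≈ (suc k) []       = origin≈ ∷ resize≈ k []
    resize≈ (suc k) (p ∷ ps) = p ∷ resize≈ k ps

  variables≈ : ∀ (ns : Vec ℕ n) → At._≈*_ (map embed ns) variables ns
  variables≈ ns = subst (Pointwise _ _) (tabulate∘lookup ns)
    (tabulate⁺ λ i → At.⟨ lookup-map i embed ns ⟩)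

  -- The axioms determine the function symbols above the origin.

  module Correctness (L : List Node) (N : ℕ) where
    open Translation L N

    -- Arguments below the origin are left unconstrained, because the axioms are asserted only for
    -- variables above it.
    Faithful : ∀ {s} → s ∈ L → Set
    Faithful {k , F} s∈L =
      ∀ ns → function (suc k) (toℕ (index s∈L)) (map embed ns) ≡ embed (F ns)

    mutual

      -- Faithfulness of the symbols used by `f`, arranged along the structure of `f` so that
      -- `axioms⁻` can establish it for subprograms first.
      Correct : (f : PartialRecursive n) → nodes f ⊆ L → Set
      Correct zero        ⊆L = ⊤
      Correct succ        ⊆L = ⊤
      Correct (proj i)    ⊆L = ⊤
      Correct (comp f gs) ⊆L =
        Correct f (⊆L ∘ ∈-++⁺ˡ) × Correct* gs (⊆L ∘ ∈-++⁺ʳ (nodes f))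
      Correct (prec f g)  ⊆L =
        Correct f (⊆L ∘ there ∘ ∈-++⁺ˡ) ×
        Correct g (⊆L ∘ there ∘ ∈-++⁺ʳ (nodes f)) ×
        Faithful (⊆L (here refl))
      Correct (μ f)       ⊆L =
        Correct f (⊆L ∘ there) × Faithful (⊆L (here refl))

      Correct* : (gs : Vec (PartialRecursive n) m) → nodes* gs ⊆ L → Set
      Correct* []       ⊆L = ⊤
      Correct* (g ∷ gs) ⊆L =
        Correct g (⊆L ∘ ∈-++⁺ˡ) × Correct* gs (⊆L ∘ ∈-++⁺ʳ (nodes g))

    mutual

      faithful⇒correct : (∀ {s} (s∈L : s ∈ L) → Faithful s∈L) →
                         ∀ (f : PartialRecursive n) (⊆L : nodes f ⊆ L) → Correct f ⊆L
      faithful⇒correct F zero        ⊆L = tt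
      faithful⇒correct F succ        ⊆L = tt
      faithful⇒correct F (proj i)    ⊆L = tt
      faithful⇒correct F (comp f gs) ⊆L =
        faithful⇒correct F f _ , faithful⇒correct* F gs _
      faithful⇒correct F (prec f g)  ⊆L =
        faithful⇒correct F f _ , faithful⇒correct F g _ , F _
      faithful⇒correct F (μ f)       ⊆L = faithful⇒correct F f _ , F _

      faithful⇒correct* : (∀ {s} (s∈L : s ∈ L) → Faithful s∈L) →
                          ∀ (gs : Vec (PartialRecursive n) m) (⊆L : nodes* gs ⊆ L) →
                          Correct* gs ⊆L
      faithful⇒correct* F []       ⊆L = tt
      faithful⇒correct* F (g ∷ gs) ⊆L =
        faithful⇒correct F g _ , faithful⇒correct* F gs _

    module _ (ρ : Vec ℤ N) where
      open At ρ

      app≈⁺ : ∀ {i} {us : Vec (Term N) k} {ns n} →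
              function k i (map embed ns) ≡ embed n → us ≈* ns → app (sym i) us ≈ n
      app≈⁺ eq ps = ⟨ trans (cong (function _ _) (values ps)) eq ⟩

      app≈⁻ : ∀ {i} {us : Vec (Term N) k} {ns n} →
              app (sym i) us ≈ n → us ≈* ns → function k i (map embed ns) ≡ embed n
      app≈⁻ ⟨ eq ⟩ ps = trans (cong (function _ _) (≡.sym (values ps))) eq

      mutual

        translate≈ : ∀ (f : PartialRecursive n) (⊆L : nodes f ⊆ L) → Correct f ⊆L →
                     ∀ {t k us ns} → t ≈ k → us ≈* ns →
                     translate f ⊆L t us ≈ eval f k ns
        translate≈ zero        ⊆L c            p []       = succ≈ origin≈
        translate≈ succ        ⊆L c            p (q ∷ []) = succ≈ (succ≈ q)
        translate≈ (proj i)    ⊆L c            p qs       = succ≈ (Pointwise.lookup qs i)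
        translate≈ (comp f gs) ⊆L (c , c*)     p qs       =
          let rs = translate*≈ gs _ c* p qs
          in strict≈ rs (translate≈ f _ c p (pred₀≈* rs))
        translate≈ (prec f g)  ⊆L (_ , _ , c)  p (q ∷ qs) = app≈⁺ (c _) (p ∷ q ∷ qs)
        translate≈ (μ f)       ⊆L (_ , c)      p qs       =
          app≈⁺ (c _) (p ∷ p ∷ origin≈ ∷ qs)

        translate*≈ : ∀ (gs : Vec (PartialRecursive n) m) (⊆L : nodes* gs ⊆ L) →
                      Correct* gs ⊆L → ∀ {t k us ns} → t ≈ k → us ≈* ns →
                      translate* gs ⊆L t us ≈* eval* gs k ns
        translate*≈ []       ⊆L c        p qs = []
        translate*≈ (g ∷ gs) ⊆L (c , c*) p qs =
          translate≈ g _ c p qs ∷ translate*≈ gs _ c* p qs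

      module _ (f : PartialRecursive n) (g : PartialRecursive (2 + n))
               (⊆L : nodes (prec f g) ⊆ L)
               (cf : Correct f (⊆L ∘ there ∘ ∈-++⁺ˡ))
               (cg : Correct g (⊆L ∘ there ∘ ∈-++⁺ʳ (nodes f))) where

        private
          symbolValue : Vec ℕ (2 + n) → ℤ
          symbolValue ns = function _ (toℕ (index (⊆L (here refl)))) (map embed ns)

        -- The two conjuncts give the base and the step of an induction on `j`. The step assumes a
        -- value at `j`, as nothing else ensures that the symbol stays above the origin there.
        recurseAxiom⁻ : ∀ {us k j ns} → us ≈* k ∷ j ∷ ns →
                        Holds (recurseAxiom f g ⊆L us) →
                        symbolValue (k ∷ 0 ∷ ns) ≡ embed (eval f k ns) ×
                        (∀ {v} → symbolValue (k ∷ j ∷ ns) ≡ embed v →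
                         symbolValue (k ∷ suc j ∷ ns) ≡
                         embed (ifZero v 0 (eval g k (j ∷ ℕ.pred v ∷ ns))))
        recurseAxiom⁻ (p ∷ q ∷ ps) h =
          let h₀ , h₁ = ∧⁻ h in
          app≈⁻ (≐⁻ h₀ (translate≈ f _ cf p ps)) (p ∷ origin≈ ∷ ps) ,
          λ eq → let r = app≈⁺ eq (p ∷ q ∷ ps) in
            app≈⁻ (≐⁻ h₁ (ifOrigin≈ r (λ _ → origin≈) λ _ →
                     translate≈ g _ cg p (q ∷ pred₀≈ r ∷ ps)))
                  (p ∷ succ≈ q ∷ ps)

        recurseAxiom⁺ : ∀ {us ns} → us ≈* ns → Faithful (⊆L (here refl)) →
                        Holds (recurseAxiom f g ⊆L us)
        recurseAxiom⁺ (p ∷ q ∷ ps) c =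
          let r = app≈⁺ (c _) (p ∷ q ∷ ps) in
          ∧⁺ (≐⁺ (app≈⁺ (c _) (p ∷ origin≈ ∷ ps)) (translate≈ f _ cf p ps))
             (≐⁺ (app≈⁺ (c _) (p ∷ succ≈ q ∷ ps))
                 (ifOrigin≈ r (λ _ → origin≈) λ _ →
                   translate≈ g _ cg p (q ∷ pred₀≈ r ∷ ps)))

      module _ (f : PartialRecursive (1 + n)) (⊆L : nodes (μ f) ⊆ L)
               (cf : Correct f (⊆L ∘ there)) where

        private
          symbolValue : Vec ℕ (3 + n) → ℤ
          symbolValue ns = function _ (toℕ (index (⊆L (here refl)))) (map embed ns)

        -- Here the induction is on the bound `b`, for all `y` at once: the step appeals to the
        -- smaller bound at the candidate `suc y`.
        searchAxiom⁻ : ∀ {us k b y ns} → us ≈* k ∷ b ∷ y ∷ ns →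
                       Holds (searchAxiom f ⊆L us) →
                       symbolValue (k ∷ 0 ∷ y ∷ ns) ≡ embed 0 ×
                       (∀ {v} → symbolValue (k ∷ b ∷ suc y ∷ ns) ≡ embed v →
                        symbolValue (k ∷ suc b ∷ y ∷ ns) ≡
                        embed (ifZero (eval f k (y ∷ ns)) 0
                                (ifZero (ℕ.pred (eval f k (y ∷ ns))) (suc y) v)))
        searchAxiom⁻ (p ∷ q ∷ r ∷ ps) h =
          let h₀ , h₁ = ∧⁻ h
              e = translate≈ f _ cf p (r ∷ ps) in
          app≈⁻ (≐⁻ h₀ origin≈) (p ∷ origin≈ ∷ r ∷ ps) ,
          λ eq →
            app≈⁻ (≐⁻ h₁ (ifOrigin≈ e (λ _ → origin≈) λ _ →
                     ifOrigin≈ (pred₀≈ e) (λ _ → succ≈ r) λ _ →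
                       app≈⁺ eq (p ∷ q ∷ succ≈ r ∷ ps)))
                  (p ∷ succ≈ q ∷ r ∷ ps)

        searchAxiom⁺ : ∀ {us ns} → us ≈* ns → Faithful (⊆L (here refl)) →
                       Holds (searchAxiom f ⊆L us)
        searchAxiom⁺ (p ∷ q ∷ r ∷ ps) c =
          let e = translate≈ f _ cf p (r ∷ ps) in
          ∧⁺ (≐⁺ (app≈⁺ (c _) (p ∷ origin≈ ∷ r ∷ ps)) origin≈)
             (≐⁺ (app≈⁺ (c _) (p ∷ succ≈ q ∷ r ∷ ps))
                 (ifOrigin≈ e (λ _ → origin≈) λ _ →
                   ifOrigin≈ (pred₀≈ e) (λ _ → succ≈ r) λ _ →
                     app≈⁺ (c _) (p ∷ q ∷ succ≈ r ∷ ps)))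

      module _ {ms : Vec ℕ N} (variables≈ms : variables ≈* ms) where
        mutual

          axioms⁺ : ∀ (f : PartialRecursive n) (⊆L : nodes f ⊆ L) →
                    Correct f ⊆L → Holds (axioms f ⊆L)
          axioms⁺ zero        ⊆L c              = ⊤⁺
          axioms⁺ succ        ⊆L c              = ⊤⁺
          axioms⁺ (proj i)    ⊆L c              = ⊤⁺
          axioms⁺ (comp f gs) ⊆L (c , c*)       = ∧⁺ (axioms⁺ f _ c) (axioms*⁺ gs _ c*)
          axioms⁺ (prec f g)  ⊆L (cf , cg , c)  =
            ∧⁺ (axioms⁺ f _ cf) (∧⁺ (axioms⁺ g _ cg)
              (recurseAxiom⁺ f g ⊆L cf cg (resize≈ _ variables≈ms) c))
          axioms⁺ (μ f)       ⊆L (cf , c)       =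
            ∧⁺ (axioms⁺ f _ cf) (searchAxiom⁺ f ⊆L cf (resize≈ _ variables≈ms) c)

          axioms*⁺ : ∀ (gs : Vec (PartialRecursive n) m) (⊆L : nodes* gs ⊆ L) →
                     Correct* gs ⊆L → Holds (axioms* gs ⊆L)
          axioms*⁺ []       ⊆L c        = ⊤⁺
          axioms*⁺ (g ∷ gs) ⊆L (c , c*) = ∧⁺ (axioms⁺ g _ c) (axioms*⁺ gs _ c*)

    Valid : Formula N → Set
    Valid φ = ∀ ns → At.Holds (map embed ns) φ

    module _ (arity≤N : ∀ {s} → s ∈ L → suc (proj₁ s) ≤ N) where

      -- The variables of an axiom for a symbol of arity k are the first k ones.
      instantiate : ∀ {s} → s ∈ L → ∀ ns →
                    At._≈*_ (map embed (resize 0 N ns))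
                      (resize origin (suc (proj₁ s)) variables) ns
      instantiate s∈L ns = subst (At._≈*_ _ _)
        (resize-resize 0 ns (arity≤N s∈L))
        (At.resize≈ _ _ (variables≈ (resize 0 N ns)))

      mutual

        -- Induction on `f`. Once the subprograms are correct, the right-hand sides of the recursion
        -- equations denote the intended numbers, and an inner induction on the recursion argument
        -- or the bound fixes the values of the new symbol.
        axioms⁻ : ∀ (f : PartialRecursive n) (⊆L : nodes f ⊆ L) →
                  Valid (axioms f ⊆L) → Correct f ⊆L
        axioms⁻ zero        ⊆L h = tt
        axioms⁻ succ        ⊆L h = tt
        axioms⁻ (proj i)    ⊆L h = tt
        axioms⁻ (comp f gs) ⊆L h =
          axioms⁻ f _ (λ ns → proj₁ (At.∧⁻ _ (h ns))) ,
          axioms*⁻ gs _ (λ ns → proj₂ (At.∧⁻ _ (h ns)))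
        axioms⁻ (prec f g)  ⊆L h = cf , cg , λ where (k ∷ j ∷ ns) → faithful k j ns
          where
          cf = axioms⁻ f _ (λ ns → proj₁ (At.∧⁻ _ (h ns)))
          cg = axioms⁻ g _ (λ ns → proj₁ (At.∧⁻ _ (proj₂ (At.∧⁻ _ (h ns)))))
          equations = λ k j ns → recurseAxiom⁻ _ f g ⊆L cf cg
            (instantiate (⊆L (here refl)) (k ∷ j ∷ ns)) (proj₂ (At.∧⁻ _ (proj₂ (At.∧⁻ _ (h _)))))
          faithful : ∀ k j ns → function _ _ (map embed (k ∷ j ∷ ns)) ≡
                                embed (recurse (eval f k) (eval g k) j ns)
          faithful k zero    ns = proj₁ (equations k 0 ns)
          faithful k (suc j) ns = proj₂ (equations k j ns) (faithful k j ns)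
        axioms⁻ (μ f)       ⊆L h = cf , λ where (k ∷ b ∷ y ∷ ns) → faithful k b y ns
          where
          cf = axioms⁻ f _ (λ ns → proj₁ (At.∧⁻ _ (h ns)))
          equations = λ k b y ns → searchAxiom⁻ _ f ⊆L cf
            (instantiate (⊆L (here refl)) (k ∷ b ∷ y ∷ ns)) (proj₂ (At.∧⁻ _ (h _)))
          faithful : ∀ k b y ns → function _ _ (map embed (k ∷ b ∷ y ∷ ns)) ≡
                                  embed (search (λ y → eval f k (y ∷ ns)) b y)
          faithful k zero    y ns = proj₁ (equations k 0 y ns)
          faithful k (suc b) y ns =
            proj₂ (equations k b y ns) (faithful k b (suc y) ns)

        axioms*⁻ : ∀ (gs : Vec (PartialRecursive n) m) (⊆L : nodes* gs ⊆ L) →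
                   Valid (axioms* gs ⊆L) → Correct* gs ⊆L
        axioms*⁻ []       ⊆L h = tt
        axioms*⁻ (g ∷ gs) ⊆L h =
          axioms⁻ g _ (λ ns → proj₁ (At.∧⁻ _ (h ns))) ,
          axioms*⁻ gs _ (λ ns → proj₂ (At.∧⁻ _ (h ns)))

-- The standard model.

-- The number `i` selects a node whatever the arity `m` is, so the arguments are resized; at the
-- arity of the node itself this changes nothing.
apply : List Node → ℕ → Vec ℕ m → ℕ
apply []            i       xs = 0
apply ((k , F) ∷ L) zero    xs = F (resize 0 (suc k) xs)
apply (_ ∷ L)       (suc i) xs = apply L i xs

apply-index : ∀ {k F L} (s∈L : (k , F) ∈ L) xs → apply L (toℕ (index s∈L)) xs ≡ F xs
apply-index {F = F} (here refl) xs = cong F (resize-id 0 xs)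
apply-index (there s∈L) xs = apply-index s∈L xs

-- With 0 as origin, `∣_∣` is a left inverse of `embed`; on negative arguments it merely provides
-- some value.
standard : List Node → (q r t : ℕ) → Interpretation
standard L q r t = record { function = function; relation = λ k i xs → false }
  where
  function : (k i : ℕ) → Vec ℤ k → ℤ
  function zero    0 [] = + 0
  function zero    1 [] = + q
  function zero    2 [] = + r
  function zero    _ [] = + t
  function (suc k) i xs = + apply L i (map ∣_∣ xs)

-- Reduction of termination and of divergence to satisfiability.

module Halting (g : PartialRecursive 2) where

  private
    L : List Node
    L = nodes g

  -- Large enough for the axioms of every symbol, and positive, so that `allFailures` has a variable
  -- to use as fuel.
  N : ℕ
  N = suc (max 0 (List.map proj₁ L))

  open Translation L N

  private
    arity≤N : ∀ {s} → s ∈ L → suc (proj₁ s) ≤ N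
    arity≤N s∈L = s≤s (All.lookup (xs≤max 0 (List.map proj₁ L)) (∈-map⁺ proj₁ s∈L))

  result : Term N → Term N
  result t = translate g id t (constant 1 ∷ constant 2 ∷ [])

  -- The premise relativises the universal quantifiers to the numbers above the origin.
  theory : Formula N → Formula N
  theory φ = ¬′ nonNegative variables ∨′ (axioms g id ∧′ φ)

  -- A constant may denote any integer, so `someSuccess` must itself require its fuel to be above
  -- the origin. For the variable in `allFailures` the premise of `theory` does so.
  someSuccess allFailures : Formula N
  someSuccess = ¬′ (constant 3 ≺ origin) ∧′ ¬′ (result (constant 3) ≐ origin)
  allFailures = result (var zero) ≐ origin

  halts diverges : Formula N
  halts    = theory someSuccess
  diverges = theory allFailures

  module _ {q r : ℕ} where

    module _ {φ : Formula N} {I : Interpretation} where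
      open Denotation I

      -- Correctness of the symbols uses the axioms at all assignments above the origin; the
      -- evaluation of `result` then follows at the given one.
      theory⁻ : I ⊨ withInputs (theory φ) q r → ∀ ns →
                let open At (map embed ns) in
                Holds φ × (∀ {t k} → t ≈ k → result t ≈ eval g k (q ∷ r ∷ []))
      theory⁻ h ns =
        proj₂ (∧⁻ (conclusion ns)) ,
        λ p → translate≈ (map embed ns) g id
          (axioms⁻ arity≤N g id λ ns → proj₁ (At.∧⁻ _ (conclusion ns)))
          p (≐⁻ (proj₁ inputs) (numeral≈ q) ∷ ≐⁻ (proj₂ inputs) (numeral≈ r) ∷ [])
        where
        open Correctness L N
        open At (map embed ns)
        sentence : Valid (theory φ ∧′ constant 1 ≐ numeral q ∧′ constant 2 ≐ numeral r)
        sentence ns = At.⟨ h (map embed ns) ⟩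
        conclusion : Valid (axioms g id ∧′ φ)
        conclusion ns = At.⇒⁻ _ (proj₁ (At.∧⁻ _ (sentence ns)))
                                (At.nonNegative⁺ _ (variables≈ ns))
        inputs = ∧⁻ (proj₂ (∧⁻ (sentence ns)))

    module _ {t : ℕ} where
      open Denotation (standard L q r t)

      constant≈ : (ρ : Vec ℤ n) → let open At ρ in
                  constant 1 ≈ q × constant 2 ≈ r × constant 3 ≈ t
      constant≈ ρ = At.⟨ refl ⟩ , At.⟨ refl ⟩ , At.⟨ refl ⟩

    module _ {φ : Formula N} {t : ℕ} where
      open Denotation (standard L q r t)
      open Correctness L N

      -- At an assignment that goes below the origin the premise of `theory` fails; at any other,
      -- the variables denote numbers `ms`, and the axioms hold because the symbols are interpreted
      -- by their nodes.
      theory⁺ : (∀ ρ {ms} → let open At ρ in variables ≈* ms →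
                 (∀ {u k} → u ≈ k → result u ≈ eval g k (q ∷ r ∷ [])) → Holds φ) →
                standard L q r t ⊨ withInputs (theory φ) q r
      theory⁺ h ρ = truth (∧⁺
        (⇒⁺ λ nonNeg → let _ , p = nonNegative⁻ variables nonNeg in
          ∧⁺ (axioms⁺ ρ p g id correct)
             (h ρ p λ q → translate≈ ρ g id correct q (in₁ ∷ in₂ ∷ [])))
        (∧⁺ (≐⁺ in₁ (numeral≈ q)) (≐⁺ in₂ (numeral≈ r))))
        where
        open At ρ
        in₁ = proj₁ (constant≈ {t} ρ)
        in₂ = proj₁ (proj₂ (constant≈ {t} ρ))
        correct : Correct g id
        correct = faithful⇒correct
          (λ {s} s∈L ns → cong +_ (trans
            (cong (apply L (toℕ (index s∈L)))
              (trans (≡.sym (map-∘ ∣_∣ embed ns)) (map-id ns)))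
            (apply-index s∈L ns)))
          g id

    halts-satisfiable : Satisfiable (withInputs halts q r) ⇔ g ↓ (q ∷ r ∷ [])
    halts-satisfiable = mk⇔ to from
      where
      to : _ → _
      -- `someSuccess` contains no variables, so the assignment is an arbitrary choice.
      to (I , h) with theory⁻ {φ = someSuccess} h (Vec.replicate N 0)
      ... | goal , result≈ =
        let open Denotation I
            open At (map embed (Vec.replicate N 0))
            t≥0 , stopped = ∧⁻ goal
            t , p = ⊀origin⁻ t≥0
            y , eq = suc-of (≭origin⁻ stopped (result≈ p))
        in y , eval-sound g t _ eq
        where
        suc-of : ∀ {n} → n ≢ 0 → ∃ λ y → n ≡ suc y
        suc-of {zero}  n≢0 = contradiction refl n≢0
        suc-of {suc n} n≢0 = n , refl
      from : _ → _
      from (y , d) =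
        let t , eq = eval-complete d
            open Denotation (standard L q r t)
        in standard L q r t , theory⁺ {someSuccess} λ ρ _ result≈ →
          let open At ρ
              _ , _ , time≈ = constant≈ {t} ρ in
          ∧⁺ (⊀origin⁺ time≈)
             (≭origin⁺ (result≈ time≈)
               λ z → 0≢1+n (trans (≡.sym z) (eq t ≤-refl)))

    diverges-satisfiable : Satisfiable (withInputs diverges q r) ⇔ (¬ g ↓ (q ∷ r ∷ []))
    diverges-satisfiable = mk⇔ to from
      where
      to : _ → _
      to (I , h) (y , d) =
        let t , eq = eval-complete d
            open Denotation I
            -- The universal fuel variable is instantiated by an amount that suffices for the
            -- terminating computation.
            open At (map embed (Vec.replicate N t))
            goal , result≈ = theory⁻ {φ = allFailures} h (Vec.replicate N t)
        in 0≢1+n (trans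
             (value≡⁻ (≐⁻ goal origin≈) (result≈ {var zero} {t} ⟨ refl ⟩) refl)
             (eq t ≤-refl))
      from : _ → _
      from ¬d =
        let open Denotation (standard L q r 0)
        in standard L q r 0 , theory⁺ {allFailures} λ { ρ (p ∷ _) result≈ →
          let open At ρ in
          ≐⁺ (result≈ p) (subst (_ ≈_) (≡.sym (undefined _)) origin≈) }
        where
        undefined : ∀ t → eval g t (q ∷ r ∷ []) ≡ 0
        undefined t with eval g t (q ∷ r ∷ []) in eq
        ... | zero  = refl
        ... | suc y = contradiction (y , eval-sound g t _ eq) ¬d

-- Computing the code of a self-applied formula.

constᵖ : ℕ → PartialRecursive n
constᵖ zero    = comp zero []
constᵖ (suc k) = comp succ (constᵖ k ∷ [])

constᵖ⇓ : ∀ k {xs : Vec ℕ n} → constᵖ k [ xs ]⇓ k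
constᵖ⇓ zero    = comp [] zero
constᵖ⇓ (suc k) = comp (constᵖ⇓ k ∷ []) succ

addᵖ : PartialRecursive 2
addᵖ = prec (proj zero) (comp succ (proj (suc zero) ∷ []))

addᵖ⇓ : ∀ x y → addᵖ [ x ∷ y ∷ [] ]⇓ x + y
addᵖ⇓ zero    y = prec-zero proj
addᵖ⇓ (suc x) y = prec-suc (addᵖ⇓ x y) (comp (proj ∷ []) succ)

triangularᵖ : PartialRecursive 1
triangularᵖ = prec zero (comp addᵖ (comp succ (proj zero ∷ []) ∷ proj (suc zero) ∷ []))

triangularᵖ⇓ : ∀ x → triangularᵖ [ x ∷ [] ]⇓ triangular x
triangularᵖ⇓ zero    = prec-zero zero
triangularᵖ⇓ (suc x) =
  prec-suc (triangularᵖ⇓ x) (comp (comp (proj ∷ []) succ ∷ proj ∷ []) (addᵖ⇓ (suc x) _))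

pairᵖ : PartialRecursive n → PartialRecursive n → PartialRecursive n
pairᵖ f g = comp addᵖ (comp triangularᵖ (comp addᵖ (f ∷ g ∷ []) ∷ []) ∷ g ∷ [])

pairᵖ⇓ : ∀ {f g : PartialRecursive n} {xs a b} →
         f [ xs ]⇓ a → g [ xs ]⇓ b → pairᵖ f g [ xs ]⇓ pair a b
pairᵖ⇓ {a = a} {b} d e =
  comp (comp (comp (d ∷ e ∷ []) (addᵖ⇓ a b) ∷ []) (triangularᵖ⇓ (a + b)) ∷ e ∷ [])
       (addᵖ⇓ (triangular (a + b)) b)

-- Transparent codes would be evaluated to huge unary numbers.
opaque

  numeralCode : ℕ → ℕ
  numeralCode k = ⌜ numeral {0} k ⌝ᵗ

  -- Numerals contain no variables, so their codes are the same in every scope and one recursive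
  -- function serves for all `n`.
  ⌜numeral⌝ : ∀ k → ⌜ numeral {n} k ⌝ᵗ ≡ numeralCode k
  ⌜numeral⌝ zero    = refl
  ⌜numeral⌝ (suc k) = cong (pair 2) (⌜numeral⌝ k)

  numeralᵖ : PartialRecursive 1
  -- 2 is the tag of `succ` in the numbering of terms.
  numeralᵖ = prec (constᵖ (numeralCode 0)) (pairᵖ (constᵖ 2) (proj (suc zero)))

  numeralᵖ⇓ : ∀ k → numeralᵖ [ k ∷ [] ]⇓ numeralCode k
  numeralᵖ⇓ zero    = prec-zero (constᵖ⇓ _)
  numeralᵖ⇓ (suc k) = prec-suc (numeralᵖ⇓ k) (pairᵖ⇓ (constᵖ⇓ 2) proj)

opaque

  constantCode : ℕ → ℕ
  constantCode i = ⌜ constant {0} i ⌝ᵗ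

  ⌜constant⌝ : ∀ i → ⌜ constant {n} i ⌝ᵗ ≡ constantCode i
  ⌜constant⌝ i = refl

opaque

  equationCode : ℕ → ℕ → ℕ
  equationCode a b = pair 5 (pair a b)

  ⌜≐⌝ : ∀ (t u : Term n) → ⌜ t ≐ u ⌝ ≡ equationCode ⌜ t ⌝ᵗ ⌜ u ⌝ᵗ
  ⌜≐⌝ t u = refl

  equationᵖ : PartialRecursive n → PartialRecursive n → PartialRecursive n
  equationᵖ f g = pairᵖ (constᵖ 5) (pairᵖ f g)

  equationᵖ⇓ : ∀ {f g : PartialRecursive n} {xs a b} → f [ xs ]⇓ a → g [ xs ]⇓ b →
               equationᵖ f g [ xs ]⇓ equationCode a b
  equationᵖ⇓ d e = pairᵖ⇓ (constᵖ⇓ 5) (pairᵖ⇓ d e)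

opaque

  sentenceCode : (n a b c : ℕ) → ℕ
  sentenceCode n a b c = pair n (pair 3 (pair a (pair 3 (pair b c))))

  ⌜∀∧∧⌝ : ∀ (φ ψ χ : Formula n) →
          ⌜ ∀′ n (φ ∧′ ψ ∧′ χ) ⌝ˢ ≡ sentenceCode n ⌜ φ ⌝ ⌜ ψ ⌝ ⌜ χ ⌝
  ⌜∀∧∧⌝ φ ψ χ = refl

  sentenceᵖ : (e f g h : PartialRecursive n) → PartialRecursive n
  sentenceᵖ e f g h = pairᵖ e (pairᵖ (constᵖ 3) (pairᵖ f (pairᵖ (constᵖ 3) (pairᵖ g h))))

  sentenceᵖ⇓ : ∀ {e f g h : PartialRecursive n} {xs m a b c} →
               e [ xs ]⇓ m → f [ xs ]⇓ a → g [ xs ]⇓ b → h [ xs ]⇓ c →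
               sentenceᵖ e f g h [ xs ]⇓ sentenceCode m a b c
  sentenceᵖ⇓ p q r s =
    pairᵖ⇓ p (pairᵖ⇓ (constᵖ⇓ 3) (pairᵖ⇓ q (pairᵖ⇓ (constᵖ⇓ 3) (pairᵖ⇓ r s))))

inputCode : ℕ → ℕ → ℕ
inputCode i k = equationCode (constantCode i) (numeralCode k)

⌜input⌝ : ∀ i k → ⌜ constant {n} i ≐ numeral k ⌝ ≡ inputCode i k
⌜input⌝ {n} i k = trans (⌜≐⌝ {n} (constant i) (numeral k))
  (cong₂ equationCode (⌜constant⌝ {n} i) (⌜numeral⌝ {n} k))

diagonalCode : (q n : ℕ) → ℕ
diagonalCode q n = sentenceCode n q (inputCode 1 q) (inputCode 2 n)

⌜selfApplied⌝ : ∀ (φ : Formula n) → ⌜ selfApplied φ ⌝ˢ ≡ diagonalCode ⌜ φ ⌝ n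
⌜selfApplied⌝ {n} φ = trans
  (⌜∀∧∧⌝ {n} φ (constant 1 ≐ numeral ⌜ φ ⌝) (constant 2 ≐ numeral n))
  (cong₂ (sentenceCode n ⌜ φ ⌝) (⌜input⌝ {n} 1 ⌜ φ ⌝) (⌜input⌝ {n} 2 n))

inputᵖ : ℕ → PartialRecursive n → PartialRecursive n
inputᵖ i f = equationᵖ (constᵖ (constantCode i)) (comp numeralᵖ (f ∷ []))

inputᵖ⇓ : ∀ i {f : PartialRecursive n} {xs k} → f [ xs ]⇓ k →
          inputᵖ i f [ xs ]⇓ inputCode i k
inputᵖ⇓ i d = equationᵖ⇓ (constᵖ⇓ (constantCode i)) (comp (d ∷ []) (numeralᵖ⇓ _))

diagonalᵖ : PartialRecursive 2
diagonalᵖ = sentenceᵖ (proj (suc zero)) (proj zero)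
                      (inputᵖ 1 (proj zero)) (inputᵖ 2 (proj (suc zero)))

diagonalᵖ⇓ : ∀ q n → diagonalᵖ [ q ∷ n ∷ [] ]⇓ diagonalCode q n
diagonalᵖ⇓ q n = sentenceᵖ⇓ proj proj (inputᵖ⇓ 1 proj) (inputᵖ⇓ 2 proj)

-- The diagonal argument.

-- In the backward direction, a derivation for the composition contains some value of `diagonalᵖ`,
-- which determinism identifies with the code of the sentence.
f-selfApplied : ∀ (f : PartialRecursive 1) (φ : Formula n) →
                f ↓ (⌜ selfApplied φ ⌝ˢ ∷ []) ⇔ comp f (diagonalᵖ ∷ []) ↓ (⌜ φ ⌝ ∷ n ∷ [])
f-selfApplied {n} f φ = mk⇔
  (λ (y , e) → y , comp (diagonalᵖ⇓ ⌜ φ ⌝ n ∷ [])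
    (subst (λ x → f [ x ∷ [] ]⇓ y) (⌜selfApplied⌝ φ) e))
  (λ where
    (y , comp (d ∷ []) e) → y , subst (λ x → f [ x ∷ [] ]⇓ y)
      (trans (⇓-deterministic d (diagonalᵖ⇓ ⌜ φ ⌝ n)) (≡.sym (⌜selfApplied⌝ φ))) e)

¬-self-equivalent : ∀ {A : Set} → ¬ (A ⇔ (¬ A))
¬-self-equivalent {A} e = ¬a (from ¬a)
  where
  open Equivalence e
  ¬a : ¬ A
  ¬a a = to a a

-- If f enumerated S, the formula expressing the divergence of f ∘ diagonalᵖ
-- would, on its own code as input, be in S if and only if it is not.
divergence⇒¬re : ∀ {S : Sentence → Set} →
  (∀ (g : PartialRecursive 2) → ∃ λ n → Σ (Formula n) λ φ →
    ∀ q r → S (withInputs φ q r) ⇔ (¬ g ↓ (q ∷ r ∷ []))) →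
  ¬ RecursivelyEnumerable S
divergence⇒¬re express (f , enum) with express (comp f (diagonalᵖ ∷ []))
... | n , φ , S⇔¬g↓ = ¬-self-equivalent
  (⇔-trans (⇔-sym (⇔-trans (enum (selfApplied φ)) (f-selfApplied f φ))) (S⇔¬g↓ ⌜ φ ⌝ n))

satisfiable-¬re : ¬ RecursivelyEnumerable Satisfiable
satisfiable-¬re = divergence⇒¬re λ g → let open Halting g in
  N , diverges , λ q r → diverges-satisfiable

-- Negating both sides of `halts-satisfiable` makes unsatisfiability of `halts` express divergence,
-- which is what the diagonal argument asks for.
unsatisfiable-¬re : ¬ RecursivelyEnumerable Unsatisfiable
unsatisfiable-¬re = divergence⇒¬re λ g → let open Halting g in
  N , halts , λ q r → ¬-cong-⇔ halts-satisfiable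

proposition19 : (¬ RecursivelyEnumerable Satisfiable × ¬ RecursivelyEnumerable Unsatisfiable) ×
    ¬ (Σ Calculus SoundAndRefutationallyComplete)
proposition19 =
  (satisfiable-¬re , unsatisfiable-¬re) ,
  -- Soundness and completeness would turn the enumeration of the refutable sentences into one of
  -- the unsatisfiable sentences.
  λ (C , refutes⇔unsat) → let f , enum = Calculus.effective C in
    unsatisfiable-¬re (f , λ s → ⇔-trans (⇔-sym (refutes⇔unsat s)) (enum s))
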